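{- There exists a disconnected graph that is $3$-$\chi_{ig}^{A}$-game-vertex-critical, and there exists a disconnected graph that is $3$-$\chi_{ig}^{AB}$-game-vertex-critical.
   Context: All graphs are simple, undirected and finite. The independence coloring game on a graph $G$ is played by Alice and Bob in rounds, round $i$ being played with color $i$ ($i=1,2,\ldots$). Within a round the players alternate moves, each move consisting of coloring a previously uncolored vertex with the color of the round so that the vertices colored in the same round form an independent set. A round is completed when no uncolored vertex can be given the color of the round (every uncolored vertex is adjacent to a vertex colored in this round). The game is over when all vertices are colored. Alice wants to finish in as few rounds as possible, Bob in as many rounds as possible. In the A-independence coloring game every round is started by Alice; the number of rounds when both players play optimally is the A-independence game chromatic number $\chi_{ig}^{A}(G)$. In the AB-independence coloring game Alice starts the first round and each further round is started by the player who did not make the last move of the previous round; the number of rounds when both players play optimally is the AB-independence game chromatic number $\chi_{ig}^{AB}(G)$. For $x\in V(G)$, $G-x$ is the graph obtained from $G$ by deleting $x$ and all edges incident with $x$. For $\varphi\in\{\chi_{ig}^{A},\chi_{ig}^{AB}\}$, a graph $G$ is $k$-$\varphi$-game-vertex-critical if $\varphi(G)=k$ and $\varphi(G-x)\neq\varphi(G)$ for every $x\in V(G)$. -}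

module Defs where

open import Data.Bool using (if_then_else_)
open import Data.Fin using (Fin; punchIn)
open import Data.Fin.Properties using (all?; punchIn-injective)
open import Data.List using (List; []; _∷_; allFin; filter; map; null)
open import Data.List.Extrema.Nat using (min; max)
open import Data.Maybe using (Maybe; just; nothing)
open import Data.Maybe.Properties using (≡-dec)
open import Data.Nat using (ℕ; zero; suc; pred; _≟_)
open import Data.Product using (_×_)
open import Data.Vec using (Vec; lookup; replicate; _[_]≔_)
open import Function using (const; _∘_)
open import Level using (0ℓ)
open import Relation.Binary using (Rel; Decidable; Irreflexive; Symmetric)
open import Relation.Binary.Construct.Closure.ReflexiveTransitive using (Star)
open import Relation.Binary.PropositionalEquality using (_≡_; _≢_; cong)
open import Relation.Nullary using (¬_; Dec; _×-dec_; _→-dec_; ¬?)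

record Graph (n : ℕ) : Set₁ where
  field
    Adjacent  : Rel (Fin n) 0ℓ
    adjacent? : Decidable Adjacent
    symmetric : Symmetric Adjacent
    loopless  : Irreflexive _≡_ Adjacent

open Graph public

-- punchIn x : Fin n → Fin (suc n) enumerates the vertices other than x.
delete : ∀ {n} → Graph n → Fin n → Graph (pred n)
delete {suc n} G x = record
  { Adjacent  = λ u v → Adjacent G (punchIn x u) (punchIn x v)
  ; adjacent? = λ u v → adjacent? G (punchIn x u) (punchIn x v)
  ; symmetric = symmetric G
  ; loopless  = λ u≡v → loopless G (cong (punchIn x) u≡v)
  }

Connected : ∀ {n} → Graph n → Set
Connected G = ∀ u v → Star (Adjacent G) u v

Disconnected : ∀ {n} → Graph n → Set
Disconnected G = ¬ Connected G

data Player : Set where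
  alice bob : Player

opponent : Player → Player
opponent alice = bob
opponent bob   = alice

-- Colours are the round numbers 1, 2, …; nothing marks an uncoloured vertex.
Colouring : ℕ → Set
Colouring n = Vec (Maybe ℕ) n

Legal : ∀ {n} → Graph n → Colouring n → ℕ → Fin n → Set
Legal G κ i v =
  lookup κ v ≡ nothing × (∀ w → Adjacent G v w → lookup κ w ≢ just i)

legal? : ∀ {n} (G : Graph n) κ i v → Dec (Legal G κ i v)
legal? G κ i v =
  ≡-dec _≟_ (lookup κ v) nothing
    ×-dec all? (λ w → adjacent? G v w →-dec ¬? (≡-dec _≟_ (lookup κ w) (just i)))

legalMoves : ∀ {n} → Graph n → Colouring n → ℕ → List (Fin n)
legalMoves {n} G κ i = filter (legal? G κ i) (allFin n)

record Position (n : ℕ) : Set where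
  constructor position
  field
    colouring : Colouring n
    completed : ℕ
    toMove    : Player

open Position public

currentRound : ∀ {n} → Position n → ℕ
currentRound P = suc (completed P)

-- The player who made the last move of a round ↦ the starter of the next round.
StartingRule : Set
StartingRule = Player → Player

-- A round is completed as soon as a move leaves no legal move in its colour.
play : ∀ {n} → StartingRule → Graph n → Position n → Fin n → Position n
play starter G P v =
  if null (legalMoves G κ (currentRound P))
  then position κ (suc (completed P)) (starter (toMove P))
  else position κ (completed P) (opponent (toMove P))
  where κ = colouring P [ v ]≔ just (currentRound P)

optimum : Player → ℕ → List ℕ → ℕ
optimum alice = min
optimum bob   = max

-- The minimax number of rounds, with at most m further moves to be made.
-- Between moves a legal move exists unless every vertex is coloured, so the
-- game is over when there is none.
rounds : ∀ {n} → StartingRule → Graph n → (m : ℕ) → Position n → ℕ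
rounds starter G zero    P = completed P
rounds {n} starter G (suc m) P with legalMoves G (colouring P) (currentRound P)
... | []     = completed P
... | v ∷ vs = optimum (toMove P) (value v) (map value vs)
  where
  value : Fin n → ℕ
  value = rounds starter G m ∘ play starter G P

-- Each move colours exactly one new vertex, so a game on n vertices lasts
-- exactly n moves.
gameChromaticNumber : StartingRule → ∀ {n} → Graph n → ℕ
gameChromaticNumber starter {n} G =
  rounds starter G n (position (replicate n nothing) 0 alice)

χᴬ : ∀ {n} → Graph n → ℕ
χᴬ = gameChromaticNumber (const alice)

χᴬᴮ : ∀ {n} → Graph n → ℕ
χᴬᴮ = gameChromaticNumber opponent

GameVertexCritical : (∀ {n} → Graph n → ℕ) → ℕ → ∀ {n} → Graph n → Set
GameVertexCritical φ k G = φ G ≡ k × (∀ x → φ (delete G x) ≢ φ G)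

{-# OPTIONS --safe #-}
-- The graph C₆ ∪ 2K₁ serves for both games. Whoever moves first on the 6-cycle
-- lets the opponent shape its first colour class: answering at the opposite
-- vertex closes the class and leaves 2K₂, so that three rounds are needed,
-- while answering at distance two forces a class of a proper 2-colouring. An
-- isolated vertex is a waiting move. With two of them Bob answers waiting by
-- waiting, so Alice has to open the cycle; with one of them Alice waits and Bob
-- has to. When a cycle vertex is deleted, Alice starts at the centre of the
-- remaining path P₅, which forces the rest of the class. The games are small
-- enough for the values to be found by evaluating the game trees.
module Submission where

open import Defs
open import Data.Fin using (Fin; _≟_)
open import Data.Fin.Patterns
open import Data.Fin.Properties using (all?)
import Data.Nat as ℕ
open import Data.Product using (_×_; ∃-syntax; Σ-syntax; _,_)
open import Data.Sum using (_⊎_; swap)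
open import Data.Vec using (Vec; []; _∷_; lookup)
open import Function using (_∘_)
open import Relation.Binary.Construct.Closure.ReflexiveTransitive using (ε; _◅_)
open import Relation.Binary.PropositionalEquality using (_≡_; _≢_; refl; sym; trans)
open import Relation.Nullary using (¬_; ¬?; _×-dec_; _⊎-dec_)
open import Relation.Nullary.Decidable using (from-yes)

-- One successor per vertex suffices to encode cycles and isolated vertices; `u ≢ v` discards the
-- loops at fixed points.
functionalGraph : ∀ {n} → (Fin n → Fin n) → Graph n
functionalGraph f = record
  { Adjacent  = λ u v → u ≢ v × (f u ≡ v ⊎ f v ≡ u)
  ; adjacent? = λ u v → ¬? (u ≟ v) ×-dec (f u ≟ v ⊎-dec f v ≟ u)
  ; symmetric = λ (u≢v , e) → u≢v ∘ sym , swap e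
  ; loopless  = λ u≡v (u≢v , _) → u≢v u≡v
  }

C₆∪2K₁ : Graph 8
C₆∪2K₁ = functionalGraph
  -- The 6-cycle runs through `0F` to `5F`; the fixed points `6F` and `7F` are the isolated
  -- vertices.
  (lookup (1F ∷ 2F ∷ 3F ∷ 4F ∷ 5F ∷ 0F ∷ 6F ∷ 7F ∷ []))

isolated⇒disconnected : ∀ {n} (G : Graph n) {u v} → u ≢ v →
                        (∀ w → ¬ Adjacent G u w) → Disconnected G
isolated⇒disconnected G {u} {v} u≢v isolated connected with connected u v
... | ε     = u≢v refl
... | e ◅ _ = isolated _ e

C₆∪2K₁-disconnected : Disconnected C₆∪2K₁
C₆∪2K₁-disconnected = isolated⇒disconnected C₆∪2K₁ {6F} {0F} (λ ())
  (from-yes (all? λ w → ¬? (adjacent? C₆∪2K₁ 6F w)))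

-- Comparing each deletion with one value `m` instead of `φ G` keeps the larger game on `G` out of
-- the check over all `x`.
critical : (φ : ∀ {n} → Graph n → ℕ.ℕ) → ∀ {k m n} {G : Graph n} → m ≢ k →
           φ G ≡ k → (∀ x → φ (delete G x) ≡ m) → GameVertexCritical φ k G
critical φ m≢k φG≡k φG-x≡m =
  φG≡k , λ x φG-x≡φG → m≢k (trans (sym (φG-x≡m x)) (trans φG-x≡φG φG≡k))

χᴬ-critical : GameVertexCritical χᴬ 3 C₆∪2K₁
χᴬ-critical = critical χᴬ {k = 3} {m = 2} {G = C₆∪2K₁} (λ ()) refl
  (from-yes (all? λ x → χᴬ (delete C₆∪2K₁ x) ℕ.≟ 2))

χᴬᴮ-critical : GameVertexCritical χᴬᴮ 3 C₆∪2K₁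
χᴬᴮ-critical = critical χᴬᴮ {k = 3} {m = 2} {G = C₆∪2K₁} (λ ()) refl
  (from-yes (all? λ x → χᴬᴮ (delete C₆∪2K₁ x) ℕ.≟ 2))

proposition17 : (∃[ n ] Σ[ G ∈ Graph n ] (Disconnected G × GameVertexCritical χᴬ 3 G))
    × (∃[ n ] Σ[ G ∈ Graph n ] (Disconnected G × GameVertexCritical χᴬᴮ 3 G))
proposition17 =
  (8 , C₆∪2K₁ , C₆∪2K₁-disconnected , χᴬ-critical) ,
  (8 , C₆∪2K₁ , C₆∪2K₁-disconnected , χᴬᴮ-critical)
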